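{- Let $n$ and $r$ be nonnegative integers, and let $G$ be an $(n+r+2)$-connected graph. If the isolated toughness of $G$ satisfies $I(G)>\frac{n+r+3}{2(r+2)}$, then $G$ is $(P_{\geq2},n)$-factor critical avoidable; that is, for every $W\subseteq V(G)$ with $|W|=n$ and every edge $e\in E(G-W)$, the graph $G-W-e$ has a $P_{\geq 2}$-factor.
   Context: All graphs are finite, undirected and simple. For $X\subseteq V(G)$, $G-X$ is obtained by deleting the vertices of $X$; for an edge $e$, $G-e$ deletes $e$. $i(G)$ denotes the number of isolated vertices of $G$. The isolated toughness of $G$ is $I(G)=+\infty$ if $G$ is complete, and otherwise $I(G)=\min\{|X|/i(G-X): X\subseteq V(G),\ i(G-X)\geq 2\}$. A path factor of $G$ is a spanning subgraph every component of which is a path of order at least 2; for an integer $k\geq2$, a $P_{\geq k}$-factor is a path factor each of whose components has at least $k$ vertices. $G$ is $P_{\geq k}$-factor avoidable if for every $e\in E(G)$, $G$ has a $P_{\geq k}$-factor not containing $e$. $G$ is $(P_{\geq k},n)$-factor critical avoidable if for every $W\subseteq V(G)$ with $|W|=n$, $G-W$ is $P_{\geq k}$-factor avoidable. -}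

module Defs where

open import Data.Nat using (ℕ; zero; suc; _+_; _*_; _≤_; _<_)
open import Data.Bool using (Bool; true; false; not; _∧_; _∨_)
open import Data.Fin using (Fin)
open import Data.Fin.Subset using (Subset; _∈_; _∉_; ∣_∣)
open import Data.Vec using (lookup; tabulate)
open import Data.List using (List; []; _∷_; length; concat; allFin)
open import Data.List.Membership.Propositional using () renaming (_∈_ to _∈ˡ_; _∉_ to _∉ˡ_)
open import Data.List.Relation.Unary.Any using (Any)
open import Data.List.Relation.Unary.All using (All)
open import Data.Product using (Σ; _×_; _,_)
open import Data.Sum using (_⊎_)
open import Relation.Binary.PropositionalEquality using (_≡_; _≢_)
open import Relation.Nullary using (¬_)

record Graph (N : ℕ) : Set where
  field
    adj    : Fin N → Fin N → Bool
    sym    : ∀ u v → adj u v ≡ adj v u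
    irrefl : ∀ v → adj v v ≡ false
open Graph public

Adj : ∀ {N} → Graph N → Fin N → Fin N → Set
Adj G u v = adj G u v ≡ true

Complete : ∀ {N} → Graph N → Set
Complete G = ∀ u v → u ≢ v → Adj G u v

data WalkAvoiding {N} (G : Graph N) (X : Subset N) : Fin N → Fin N → Set where
  here : ∀ {u} → WalkAvoiding G X u u
  step : ∀ {u w v} → Adj G u w → w ∉ X → WalkAvoiding G X w v → WalkAvoiding G X u v

ConnectedMinus : ∀ {N} → Graph N → Subset N → Set
ConnectedMinus {N} G X = ∀ u v → u ∉ X → v ∉ X → WalkAvoiding G X u v

KConnected : ∀ {N} → Graph N → ℕ → Set
KConnected {N} G k = (k < N) × (∀ (X : Subset N) → ∣ X ∣ < k → ConnectedMinus G X)

allᵇ : ∀ {A : Set} → (A → Bool) → List A → Bool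
allᵇ p [] = true
allᵇ p (x ∷ xs) = p x ∧ allᵇ p xs

isIsolatedᵇ : ∀ {N} → Graph N → Subset N → Fin N → Bool
isIsolatedᵇ {N} G X v =
  not (lookup X v) ∧ allᵇ (λ w → not (adj G v w) ∨ lookup X w) (allFin N)

isolatedSet : ∀ {N} → Graph N → Subset N → Subset N
isolatedSet G X = tabulate (isIsolatedᵇ G X)

iso : ∀ {N} → Graph N → Subset N → ℕ
iso G X = ∣ isolatedSet G X ∣

-- I(G) > a / b  (b > 0), where I(G) = +∞ if G is complete and otherwise
-- I(G) = min { |X| / i(G-X) : i(G-X) ≥ 2 }.  For non-complete G this set
-- is finite and nonempty, so "min > a/b" means every element is > a/b,
-- i.e. |X| * b > a * i(G-X).
IsolatedToughnessGT : ∀ {N} → Graph N → ℕ → ℕ → Set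
IsolatedToughnessGT {N} G a b =
  Complete G ⊎
  ((¬ Complete G) × (∀ (X : Subset N) → 2 ≤ iso G X → a * iso G X < ∣ X ∣ * b))

data IsPathIn {N} (E : Fin N → Fin N → Set) : List (Fin N) → Set where
  single : ∀ {v} → IsPathIn E (v ∷ [])
  cons   : ∀ {u v vs} → E u v → IsPathIn E (v ∷ vs) → IsPathIn E (u ∷ v ∷ vs)

occ : ∀ {N} → Fin N → List (Fin N) → ℕ
occ v [] = 0
occ v (w ∷ ws) with v Data.Fin.≟ w
... | Relation.Nullary.yes _ = suc (occ v ws)
... | Relation.Nullary.no  _ = occ v ws

-- A P_{≥k}-factor of the graph H with vertex set S and edge relation E:
-- a family of vertex-disjoint paths of H, each of order ≥ k, covering
-- every vertex of S exactly once and no vertex outside S.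
-- (The components of a path factor are exactly these paths.)
PathFactorGE : ∀ {N} → ℕ → Subset N → (Fin N → Fin N → Set) → Set
PathFactorGE {N} k S E =
  Σ (List (List (Fin N))) λ ps →
    All (λ p → (k ≤ length p) × IsPathIn E p) ps ×
    (∀ v → (v ∈ S → occ v (concat ps) ≡ 1) × (v ∉ S → occ v (concat ps) ≡ 0))

open import Data.Fin.Subset using (∁) public

-- edge relation of G - e for e = uv  (restricted later to vertices outside W)
AdjMinusEdge : ∀ {N} → Graph N → Fin N → Fin N → Fin N → Fin N → Set
AdjMinusEdge G u v x y =
  Adj G x y × ¬ ((x ≡ u × y ≡ v) ⊎ (x ≡ v × y ≡ u))

PkFactorCriticalAvoidable : ∀ {N} → Graph N → ℕ → ℕ → Set
PkFactorCriticalAvoidable {N} G k n =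
  ∀ (W : Subset N) → ∣ W ∣ ≡ n →
  ∀ (u v : Fin N) → u ∉ W → v ∉ W → Adj G u v →
  PathFactorGE k (∁ W) (AdjMinusEdge G u v)

{-# OPTIONS --safe #-}
module Submission where

open import Defs renaming (sym to adj-sym)
open import Data.Nat using (ℕ; zero; suc; _+_; _*_; _≤_; _<_; z≤n; s≤s)
open import Data.Nat.Properties as ℕ using (module ≤-Reasoning)
open import Data.Nat.Tactic.RingSolver using (solve-∀)
open import Data.Bool using (Bool; true; false; not; _∨_; if_then_else_)
import Data.Bool.Properties as Bool
open import Data.Fin using (Fin; _≟_)
open import Data.Fin.Properties using (any?)
open import Data.Fin.Subset using (Subset; inside; outside; _∈_; _∉_; _⊆_; ∣_∣; ⊥; ⊤; ⁅_⁆; _∪_)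
open import Data.Fin.Subset.Properties using (_∈?_; ∉⊥; ∣⊥∣≡0; ∣⁅x⁆∣≡1; x∈⁅x⁆; x∈⁅y⁆⇒x≡y; x∈p∪q⁻; x∈p∪q⁺; p⊆q⇒∣p∣≤∣q∣; p⊂q⇒∣p∣<∣q∣; ∣p∣≤n; ∣⊤∣≡n; q⊆p∪q; x∈∁p⇒x∉p; x∉p⇒x∈∁p)
open import Data.Vec using ([]; _∷_; lookup)
open import Data.Vec.Properties using ([]=⇒lookup; lookup⇒[]=; lookup∘tabulate)
open import Data.List using (List; []; _∷_; _++_; length; concat; allFin)
open import Data.List.Properties using (length-++)
open import Data.List.Relation.Unary.All using (All; []; _∷_)
open import Data.Product using (Σ; ∃; _×_; _,_; proj₁; proj₂)
open import Data.Sum using (_⊎_; inj₁; inj₂; [_,_]′)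
open import Data.Empty using (⊥-elim) renaming (⊥ to Empty)
open import Relation.Binary.PropositionalEquality using (_≡_; _≢_; refl; sym; trans; cong; cong₂; subst)
open import Relation.Nullary using (¬_; ¬?; Dec; yes; no)
open import Relation.Nullary.Decidable using (_×-dec_; _⊎-dec_; decidable-stable)

-- Akiyama–Avis–Era: a graph has a factor into paths of order 2 and 3 as soon as
-- i(H − X) ≤ 2|X| for all X.  Given a packing and an uncovered vertex v, explore
-- alternately: a vertex y that could be left uncovered instead of v either has a
-- neighbour along which the packing can be enlarged, or all its new neighbours are
-- centres of cherries, whose leaves could in turn be left uncovered.  When this
-- stops, the k reached centres isolate the 2k + 1 reached leaves.
--
-- If i(H − X) > 2|X| for H = G − W − uv, then X ≠ ∅ by connectivity, and deleting
-- W ∪ X ∪ {u} leaves at least 2|X| isolated vertices in G, so the toughness bound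
-- gives |X| ≤ r + 1.  Hence G − (W ∪ X) is connected, yet at least one of the
-- 2|X| + 1 ≥ 3 vertices isolated in H − X is not an end of uv.

private variable
  N : ℕ

-- Multiplicities in lists of vertices

-- The Kronecker delta. `occ` is stuck on an undecided comparison of vertices; expanding it into a
-- sum of `δ`s turns multiplicity identities into semiring identities, which the ring solver
-- settles.
δ : Fin N → Fin N → ℕ
δ z a = occ z (a ∷ [])

δ-refl : (z : Fin N) → δ z z ≡ 1
δ-refl z with z ≟ z
... | yes _ = refl
... | no z≢z = ⊥-elim (z≢z refl)

δ-≢ : {z a : Fin N} → z ≢ a → δ z a ≡ 0
δ-≢ {z = z} {a} z≢a with z ≟ a
... | yes z≡a = ⊥-elim (z≢a z≡a)
... | no _ = refl

occ-∷ : (z a : Fin N) (xs : List (Fin N)) → occ z (a ∷ xs) ≡ δ z a + occ z xs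
occ-∷ z a xs with z ≟ a
... | yes _ = refl
... | no _ = refl

support : List (Fin N) → Subset N
support [] = ⊥
support (x ∷ xs) = ⁅ x ⁆ ∪ support xs

∈-support⁺ : (xs : List (Fin N)) {z : Fin N} → 0 < occ z xs → z ∈ support xs
∈-support⁺ (x ∷ xs) {z} 0<occ with z ≟ x
... | yes refl = x∈p∪q⁺ (inj₁ (x∈⁅x⁆ x))
... | no _ = x∈p∪q⁺ (inj₂ (∈-support⁺ xs 0<occ))

∈-support⁻ : (xs : List (Fin N)) {z : Fin N} → z ∈ support xs → 0 < occ z xs
∈-support⁻ [] z∈ = ⊥-elim (∉⊥ z∈)
∈-support⁻ (x ∷ xs) {z} z∈ with z ≟ x | x∈p∪q⁻ ⁅ x ⁆ (support xs) z∈
... | yes _ | _ = s≤s z≤n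
... | no z≢x | inj₁ z∈⁅x⁆ = ⊥-elim (z≢x (x∈⁅y⁆⇒x≡y x z∈⁅x⁆))
... | no _ | inj₂ z∈xs = ∈-support⁻ xs z∈xs

∣p∪q∣≤∣p∣+∣q∣ : (p q : Subset N) → ∣ p ∪ q ∣ ≤ ∣ p ∣ + ∣ q ∣
∣p∪q∣≤∣p∣+∣q∣ [] [] = z≤n
∣p∪q∣≤∣p∣+∣q∣ (outside ∷ p) (outside ∷ q) = ∣p∪q∣≤∣p∣+∣q∣ p q
∣p∪q∣≤∣p∣+∣q∣ (outside ∷ p) (inside ∷ q) =
  subst (suc ∣ p ∪ q ∣ ≤_) (sym (ℕ.+-suc ∣ p ∣ ∣ q ∣)) (s≤s (∣p∪q∣≤∣p∣+∣q∣ p q))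
∣p∪q∣≤∣p∣+∣q∣ (inside ∷ p) (outside ∷ q) = s≤s (∣p∪q∣≤∣p∣+∣q∣ p q)
∣p∪q∣≤∣p∣+∣q∣ (inside ∷ p) (inside ∷ q) =
  s≤s (ℕ.≤-trans (∣p∪q∣≤∣p∣+∣q∣ p q) (ℕ.+-monoʳ-≤ ∣ p ∣ (ℕ.n≤1+n ∣ q ∣)))

∣p∪⁅x⁆∣≤1+∣p∣ : (p : Subset N) (x : Fin N) → ∣ p ∪ ⁅ x ⁆ ∣ ≤ suc ∣ p ∣
∣p∪⁅x⁆∣≤1+∣p∣ p x = ℕ.≤-trans (∣p∪q∣≤∣p∣+∣q∣ p ⁅ x ⁆)
  (ℕ.≤-reflexive (trans (cong (∣ p ∣ +_) (∣⁅x⁆∣≡1 x)) (ℕ.+-comm ∣ p ∣ 1)))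

∣support∣≤length : (xs : List (Fin N)) → ∣ support xs ∣ ≤ length xs
∣support∣≤length {N} [] = ℕ.≤-reflexive (∣⊥∣≡0 N)
∣support∣≤length (x ∷ xs) = ℕ.≤-trans (∣p∪q∣≤∣p∣+∣q∣ ⁅ x ⁆ (support xs))
  (ℕ.+-mono-≤ (ℕ.≤-reflexive (∣⁅x⁆∣≡1 x)) (∣support∣≤length xs))

-- Without repetitions the head is missing from the support of the tail, so each entry enlarges the
-- support strictly.
length≤∣support∣ : (xs : List (Fin N)) → (∀ z → occ z xs ≤ 1) → length xs ≤ ∣ support xs ∣
length≤∣support∣ [] _ = z≤n
length≤∣support∣ (x ∷ xs) occ≤1 = ℕ.≤-<-trans (length≤∣support∣ xs occ-xs≤1)
  (p⊂q⇒∣p∣<∣q∣ (q⊆p∪q ⁅ x ⁆ (support xs) , x , x∈p∪q⁺ (inj₁ (x∈⁅x⁆ x)) , x∉xs))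
  where
  occ-xs≤1 : ∀ z → occ z xs ≤ 1
  occ-xs≤1 z = ℕ.≤-trans (ℕ.m≤n+m (occ z xs) (δ z x))
    (subst (_≤ 1) (occ-∷ z x xs) (occ≤1 z))
  x∉xs : x ∉ support xs
  x∉xs x∈xs = ℕ.<⇒≱ (s≤s (∈-support⁻ xs x∈xs))
    (subst (_≤ 1) (trans (occ-∷ x x xs) (cong (_+ occ x xs) (δ-refl x))) (occ≤1 x))

∣p∣<∣q∣⇒∃∈q∉p : (p q : Subset N) → ∣ p ∣ < ∣ q ∣ → ∃ λ x → x ∈ q × x ∉ p
∣p∣<∣q∣⇒∃∈q∉p p q p<q with any? (λ x → (x ∈? q) ×-dec ¬? (x ∈? p))
... | yes found = found
... | no none = ⊥-elim (ℕ.<⇒≱ p<q (p⊆q⇒∣p∣≤∣q∣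
        (λ {x} x∈q → decidable-stable (x ∈? p) (λ x∉p → none (x , x∈q , x∉p)))))

-- A numeric indicator, so that membership in `S` can be compared with multiplicities.
χ : Subset N → Fin N → ℕ
χ S z = if lookup S z then 1 else 0

χ≤1 : (S : Subset N) (z : Fin N) → χ S z ≤ 1
χ≤1 S z with lookup S z
... | true = s≤s z≤n
... | false = z≤n

∈⇒χ≡1 : {S : Subset N} {z : Fin N} → z ∈ S → χ S z ≡ 1
∈⇒χ≡1 z∈S rewrite []=⇒lookup z∈S = refl

0<χ⇒∈ : {S : Subset N} {z : Fin N} → 0 < χ S z → z ∈ S
0<χ⇒∈ {S = S} {z} 0<χ with lookup S z in eq
... | true = lookup⇒[]= z S eq

-- Stars with one or two leaves

module StarFactor (S : Subset N) (E : Fin N → Fin N → Set)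
  (E? : ∀ x y → Dec (E x y)) (E-sym : ∀ {x y} → E x y → E y x) (E-irrefl : ∀ {x} → ¬ E x x)
  where

  record Edge : Set where
    constructor edge
    field
      {x y} : Fin N
      x~y : E x y

  record Cherry : Set where
    constructor cherry
    field
      {l c r} : Fin N
      l~c : E l c
      c~r : E c r

  occᵉ : List Edge → Fin N → ℕ
  occᵉ [] z = 0
  occᵉ (edge {x} {y} _ ∷ es) z = δ z x + δ z y + occᵉ es z

  occˡ : List Cherry → Fin N → ℕ
  occˡ [] z = 0
  occˡ (cherry {l} {_} {r} _ _ ∷ ts) z = δ z l + δ z r + occˡ ts z

  occᶜ : List Cherry → Fin N → ℕ
  occᶜ [] z = 0
  occᶜ (cherry {_} {c} {_} _ _ ∷ ts) z = δ z c + occᶜ ts z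

  occˡ-++ : ∀ ts us z → occˡ (ts ++ us) z ≡ occˡ ts z + occˡ us z
  occˡ-++ [] us z = refl
  occˡ-++ (cherry {l} {_} {r} _ _ ∷ ts) us z =
    trans (cong (δ z l + δ z r +_) (occˡ-++ ts us z)) (sym (ℕ.+-assoc (δ z l + δ z r) _ _))

  occᶜ-++ : ∀ ts us z → occᶜ (ts ++ us) z ≡ occᶜ ts z + occᶜ us z
  occᶜ-++ [] us z = refl
  occᶜ-++ (cherry {_} {c} _ _ ∷ ts) us z =
    trans (cong (δ z c +_) (occᶜ-++ ts us z)) (sym (ℕ.+-assoc (δ z c) _ _))

  covered : List Edge → List Cherry → Fin N → ℕ
  covered es ts z = occᵉ es z + (occˡ ts z + occᶜ ts z)

  size : List Edge → List Cherry → ℕ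
  size es ts = 2 * length es + 3 * length ts

  paths : List Edge → List Cherry → List (List (Fin N))
  paths (edge {x} {y} _ ∷ es) ts = (x ∷ y ∷ []) ∷ paths es ts
  paths [] (cherry {l} {c} {r} _ _ ∷ ts) = (l ∷ c ∷ r ∷ []) ∷ paths [] ts
  paths [] [] = []

  paths-valid : ∀ es ts → All (λ p → (2 ≤ length p) × IsPathIn E p) (paths es ts)
  paths-valid (edge x~y ∷ es) ts = (s≤s (s≤s z≤n) , cons x~y single) ∷ paths-valid es ts
  paths-valid [] (cherry l~c c~r ∷ ts) =
    (s≤s (s≤s z≤n) , cons l~c (cons c~r single)) ∷ paths-valid [] ts
  paths-valid [] [] = []

  occ-paths : ∀ es ts z → occ z (concat (paths es ts)) ≡ covered es ts z
  occ-paths (edge {x} {y} _ ∷ es) ts z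
    rewrite occ-∷ z x (y ∷ concat (paths es ts)) | occ-∷ z y (concat (paths es ts)) | occ-paths es ts z
    = lemma (δ z x) (δ z y) (occᵉ es z) _
    where
    lemma : ∀ a b m t → a + (b + (m + t)) ≡ a + b + m + t
    lemma = solve-∀
  occ-paths [] (cherry {l} {c} {r} _ _ ∷ ts) z
    rewrite occ-∷ z l (c ∷ r ∷ concat (paths [] ts)) | occ-∷ z c (r ∷ concat (paths [] ts))
          | occ-∷ z r (concat (paths [] ts)) | occ-paths [] ts z
    = lemma (δ z l) (δ z c) (δ z r) (occˡ ts z) (occᶜ ts z)
    where
    lemma : ∀ a c b l m → a + (c + (b + (l + m))) ≡ a + b + l + (c + m)
    lemma = solve-∀
  occ-paths [] [] z = refl

  length-paths : ∀ es ts → length (concat (paths es ts)) ≡ size es ts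
  length-paths (edge _ ∷ es) ts rewrite length-paths es ts = lemma (length es) (length ts)
    where
    lemma : ∀ a b → 2 + (2 * a + 3 * b) ≡ 2 * (1 + a) + 3 * b
    lemma = solve-∀
  length-paths [] (cherry _ _ ∷ ts) rewrite length-paths [] ts = lemma (length ts)
    where
    lemma : ∀ b → 3 + 3 * b ≡ 3 * (1 + b)
    lemma = solve-∀
  length-paths [] [] = refl

  -- One inequality encodes three facts: the stars are disjoint, the vertices within each star are
  -- distinct (in particular `l` and `r` of a cherry), and all of them lie in `S`.
  Packs : List Edge → List Cherry → Set
  Packs es ts = ∀ z → covered es ts z ≤ χ S z

  size≤N : ∀ es ts → Packs es ts → size es ts ≤ N
  size≤N es ts packs = begin
    size es ts                            ≡⟨ length-paths es ts ⟨
    length vs                             ≤⟨ length≤∣support∣ vs occ≤1 ⟩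
    ∣ support vs ∣                        ≤⟨ ∣p∣≤n (support vs) ⟩
    N                                     ∎
    where
    open ≤-Reasoning
    vs = concat (paths es ts)
    occ≤1 : ∀ z → occ z vs ≤ 1
    occ≤1 z = subst (_≤ 1) (sym (occ-paths es ts z)) (ℕ.≤-trans (packs z) (χ≤1 S z))

  LargerPacking : ℕ → Set
  LargerPacking k = Σ (List Edge) λ es → Σ (List Cherry) λ ts → Packs es ts × k < size es ts

  add-uncovered : ∀ (f : Fin N → ℕ) {w} → (∀ z → f z ≤ χ S z) → w ∈ S → f w ≡ 0 →
    ∀ z → f z + δ z w ≤ χ S z
  add-uncovered f {w} f≤χ w∈S fw≡0 z = case (z ≟ w)
    where
    case : Dec (z ≡ w) → f z + δ z w ≤ χ S z
    case (yes refl) rewrite fw≡0 | δ-refl w | ∈⇒χ≡1 w∈S = s≤s z≤n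
    case (no z≢w) rewrite δ-≢ z≢w | ℕ.+-identityʳ (f z) = f≤χ z

  swap+ : ∀ a b c → a + (b + c) ≡ b + (a + c)
  swap+ = solve-∀

  -- Locating a vertex in a packing

  record EdgeAt (w : Fin N) (es : List Edge) : Set where
    field
      {o} : Fin N
      w~o : E w o
      others : List Edge
      occ-eq : ∀ z → occᵉ es z ≡ δ z w + δ z o + occᵉ others z
      len-eq : length es ≡ suc (length others)

  edgeAt? : ∀ w es → EdgeAt w es ⊎ occᵉ es w ≡ 0
  edgeAt? w [] = inj₂ refl
  edgeAt? w (edge {x} {y} x~y ∷ es) with w ≟ x
  ... | yes refl = inj₁ (record { w~o = x~y ; others = es ; occ-eq = λ _ → refl ; len-eq = refl })
  ... | no w≢x with w ≟ y
  ...   | yes refl = inj₁ (record { w~o = E-sym x~y ; others = es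
                      ; occ-eq = λ z → cong (_+ occᵉ es z) (ℕ.+-comm (δ z x) (δ z y)) ; len-eq = refl })
  ...   | no w≢y with edgeAt? w es
  ...     | inj₂ none = inj₂ none
  ...     | inj₁ at = inj₁ (record { w~o = w~o ; others = edge x~y ∷ others
              ; occ-eq = λ z → trans (cong (δ z x + δ z y +_) (occ-eq z)) (swap+ (δ z x + δ z y) (δ z w + δ z o) (occᵉ others z))
              ; len-eq = cong suc len-eq })
    where open EdgeAt at

  -- Removing a cherry is recorded through multiplicities and lengths alone, so lists act as
  -- multisets and a cherry may be reversed. Leaves and centres are counted apart because the
  -- exploration treats them differently.
  record Extract (l c r : Fin N) (ts : List Cherry) : Set where
    field
      l~c : E l c
      c~r : E c r
      others : List Cherry
      leaves-eq : ∀ z → occˡ ts z ≡ δ z l + δ z r + occˡ others z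
      centres-eq : ∀ z → occᶜ ts z ≡ δ z c + occᶜ others z
      len-eq : length ts ≡ suc (length others)

  extract-++ˡ : ∀ us {l c r ts} → Extract l c r ts → Extract l c r (us ++ ts)
  extract-++ˡ [] x = x
  extract-++ˡ (u@(cherry {l′} {c′} {r′} _ _) ∷ us) {l} {c} {r} x = record
    { l~c = l~c ; c~r = c~r ; others = u ∷ others
    ; leaves-eq = λ z → trans (cong (δ z l′ + δ z r′ +_) (leaves-eq z))
        (swap+ (δ z l′ + δ z r′) (δ z l + δ z r) (occˡ others z))
    ; centres-eq = λ z → trans (cong (δ z c′ +_) (centres-eq z)) (swap+ (δ z c′) (δ z c) (occᶜ others z))
    ; len-eq = cong suc len-eq }
    where open Extract (extract-++ˡ us x)

  extract-++ʳ : ∀ {l c r ts} us → Extract l c r ts → Extract l c r (ts ++ us)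
  extract-++ʳ {l} {c} {r} {ts} us x = record
    { l~c = l~c ; c~r = c~r ; others = others ++ us
    ; leaves-eq = λ z → trans (occˡ-++ ts us z) (trans (cong (_+ occˡ us z) (leaves-eq z))
        (trans (ℕ.+-assoc (δ z l + δ z r) (occˡ others z) (occˡ us z)) (cong (δ z l + δ z r +_) (sym (occˡ-++ others us z)))))
    ; centres-eq = λ z → trans (occᶜ-++ ts us z) (trans (cong (_+ occᶜ us z) (centres-eq z))
        (trans (ℕ.+-assoc (δ z c) (occᶜ others z) (occᶜ us z)) (cong (δ z c +_) (sym (occᶜ-++ others us z)))))
    ; len-eq = trans (length-++ ts) (trans (cong (_+ length us) len-eq) (cong suc (sym (length-++ others)))) }
    where open Extract x

  -- By symmetry a leaf `w` is always presented as the first leaf, so a single exchange serves both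
  -- ends of a cherry.
  data CherryAt (w : Fin N) (ts : List Cherry) : Set where
    leaf   : ∀ {c r} → Extract w c r ts → CherryAt w ts
    centre : ∀ {l r} → Extract l w r ts → CherryAt w ts
    absent : occˡ ts w ≡ 0 → occᶜ ts w ≡ 0 → CherryAt w ts

  cherryAt : ∀ w ts → CherryAt w ts
  cherryAt w [] = absent refl refl
  cherryAt w (t@(cherry {l} {c} {r} l~c c~r) ∷ ts) with w ≟ l | w ≟ c | w ≟ r
  ... | yes refl | _ | _ = leaf (record { l~c = l~c ; c~r = c~r ; others = ts
          ; leaves-eq = λ _ → refl ; centres-eq = λ _ → refl ; len-eq = refl })
  ... | no _ | yes refl | _ = centre (record { l~c = l~c ; c~r = c~r ; others = ts
          ; leaves-eq = λ _ → refl ; centres-eq = λ _ → refl ; len-eq = refl })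
  ... | no _ | no _ | yes refl = leaf (record { l~c = E-sym c~r ; c~r = E-sym l~c ; others = ts
          ; leaves-eq = λ z → cong (_+ occˡ ts z) (ℕ.+-comm (δ z l) (δ z r))
          ; centres-eq = λ _ → refl ; len-eq = refl })
  ... | no w≢l | no w≢c | no w≢r with cherryAt w ts
  ...   | leaf x = leaf (extract-++ˡ (t ∷ []) x)
  ...   | centre x = centre (extract-++ˡ (t ∷ []) x)
  ...   | absent noLeaf noCentre = absent
            (trans (cong₂ (λ a b → a + b + occˡ ts w) (δ-≢ w≢l) (δ-≢ w≢r)) noLeaf)
            (trans (cong (_+ occᶜ ts w) (δ-≢ w≢c)) noCentre)

  -- cs and ls are the reached centres and leaves; rest holds the unreached cherries,
  -- and k is the size of the packing the exploration started from.  By free, any y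
  -- in ls can be the one left uncovered, the rest of ls forming cherries on cs.
  record Alternating (k : ℕ) : Set where
    field
      es : List Edge
      rest : List Cherry
      cs ls : List (Fin N)
      packs : ∀ z → covered es rest z + (occ z ls + occ z cs) ≤ χ S z
      len-ls : length ls ≡ suc (2 * length cs)
      size-eq : 2 * length es + 3 * (length rest + length cs) ≡ k
      free : ∀ y → 0 < occ y ls → Σ (List Cherry) λ qs → length qs ≡ length cs ×
        (∀ z → occˡ qs z + δ z y ≡ occ z ls) × (∀ z → occᶜ qs z ≡ occ z cs)

  open Alternating

  -- One step of the alternating exploration

  data Step {k} (A : Alternating k) : Set where
    larger : LargerPacking k → Step A
    grown : (B : Alternating k) → length (rest A) ≡ suc (length (rest B)) → Step A

  -- Rerouting by `free` leaves `y` uncovered. If `w` is the centre of an unreached cherry, that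
  -- cherry becomes reached; in every other position of `w` the edge `yw` yields a larger packing.
  step-along : ∀ {k} (A : Alternating k) {y w} → 0 < occ y (ls A) → w ∈ S → E y w →
    occ w (cs A) ≡ 0 → Step A
  step-along {k} A {y} {w} y∈ls w∈S y~w w∉cs
    with free A y y∈ls
  ... | qs , len-qs , leaves-qs , centres-qs = result
    where
    ts : List Cherry
    ts = qs ++ rest A

    len-ts : length ts ≡ length (rest A) + length (cs A)
    len-ts = trans (length-++ qs) (trans (ℕ.+-comm (length qs) _) (cong (length (rest A) +_) len-qs))

    covered-ts : ∀ z → covered (es A) ts z + δ z y ≡ covered (es A) (rest A) z + (occ z (ls A) + occ z (cs A))
    covered-ts z rewrite occˡ-++ qs (rest A) z | occᶜ-++ qs (rest A) z
      | sym (leaves-qs z) | sym (centres-qs z) =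
      lemma (occᵉ (es A) z) (occˡ qs z) (occˡ (rest A) z) (occᶜ qs z) (occᶜ (rest A) z) (δ z y)
      where
      lemma : ∀ e ql rl qc rc y → e + ((ql + rl) + (qc + rc)) + y ≡ e + (rl + rc) + ((ql + y) + qc)
      lemma = solve-∀

    -- The unit reserved at `y` is the room for a new star through `y`.
    packs-ts : ∀ z → covered (es A) ts z + δ z y ≤ χ S z
    packs-ts z = subst (_≤ χ S z) (sym (covered-ts z)) (packs A z)

    size-ts : size (es A) ts ≡ k
    size-ts = trans (cong (λ n → 2 * length (es A) + 3 * n) len-ts) (size-eq A)

    -- The edge `wo` is replaced by the cherry `y`, `w`, `o`: two covered vertices become three.
    absorb-edge : EdgeAt w (es A) → LargerPacking k
    absorb-edge at = others , cherry y~w w~o ∷ ts , packs′ , larger′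
      where
      open EdgeAt at
      packs′ : Packs others (cherry y~w w~o ∷ ts)
      packs′ z = subst (_≤ χ S z)
        (trans (cong (λ e → e + (occˡ ts z + occᶜ ts z) + δ z y) (occ-eq z))
          (lemma (δ z w) (δ z o) (occᵉ others z) (occˡ ts z) (occᶜ ts z) (δ z y))) (packs-ts z)
        where
        lemma : ∀ w o e l c y → w + o + e + (l + c) + y ≡ e + ((y + o + l) + (w + c))
        lemma = solve-∀
      larger′ : k < size others (cherry y~w w~o ∷ ts)
      larger′ = ℕ.≤-reflexive (trans (cong suc (trans (sym size-ts) (cong (λ n → 2 * n + 3 * length ts) len-eq)))
        (lemma (length others) (length ts)))
        where
        lemma : ∀ a b → 1 + (2 * (1 + a) + 3 * b) ≡ 2 * a + 3 * (1 + b)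
        lemma = solve-∀

    -- The cherry `w`, `c`, `r` is replaced by the edges `yw` and `cr`: three covered vertices
    -- become four.
    split-cherry : ∀ {c r} → Extract w c r ts → LargerPacking k
    split-cherry {c} {r} x = edge y~w ∷ edge c~r ∷ es A , others , packs′ , larger′
      where
      open Extract x
      packs′ : Packs (edge y~w ∷ edge c~r ∷ es A) others
      packs′ z = subst (_≤ χ S z)
        (trans (cong₂ (λ l m → occᵉ (es A) z + (l + m) + δ z y) (leaves-eq z) (centres-eq z))
          (lemma (occᵉ (es A) z) (δ z w) (δ z r) (occˡ others z) (δ z c) (occᶜ others z) (δ z y))) (packs-ts z)
        where
        lemma : ∀ e w r l c m y → e + (w + r + l + (c + m)) + y ≡ y + w + (c + r + e) + (l + m)
        lemma = solve-∀
      larger′ : k < size (edge y~w ∷ edge c~r ∷ es A) others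
      larger′ = ℕ.≤-reflexive (trans (cong suc (trans (sym size-ts) (cong (λ n → 2 * length (es A) + 3 * n) len-eq)))
        (lemma (length (es A)) (length others)))
        where
        lemma : ∀ a b → 1 + (2 * a + 3 * (1 + b)) ≡ 2 * (2 + a) + 3 * b
        lemma = solve-∀

    add-edge : covered (es A) ts w ≡ 0 → LargerPacking k
    add-edge uncovered = edge y~w ∷ es A , ts , packs′ , larger′
      where
      -- The unit at `y` is already spent in `packs-ts`, so there is room for `w` only if it is
      -- another vertex.
      w≢y : w ≢ y
      w≢y refl = E-irrefl y~w
      packs′ : Packs (edge y~w ∷ es A) ts
      packs′ z = subst (_≤ χ S z) (lemma (occᵉ (es A) z) (occˡ ts z + occᶜ ts z) (δ z y) (δ z w))
        (add-uncovered (λ z → covered (es A) ts z + δ z y) packs-ts w∈S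
          (trans (cong (_+ δ w y) uncovered) (δ-≢ w≢y)) z)
        where
        lemma : ∀ e t y w → e + t + y + w ≡ y + w + e + t
        lemma = solve-∀
      larger′ : k < size (edge y~w ∷ es A) ts
      larger′ = ℕ.≤-trans (ℕ.≤-reflexive (cong suc (sym size-ts)))
        (ℕ.≤-trans (ℕ.n≤1+n _) (ℕ.≤-reflexive (lemma (length (es A)) (length ts))))
        where
        lemma : ∀ a b → 2 + (2 * a + 3 * b) ≡ 2 * (1 + a) + 3 * b
        lemma = solve-∀

    grow : ∀ {l r} → Extract l w r (rest A) → Step A
    grow {l} {r} x = grown B len-eq
      where
      open Extract x
      -- To free a new leaf, `y` takes its place at the centre `w`, and `qs` serves the old centres
      -- without `y`. To free an old leaf, the cherry `l`, `w`, `r` stays and the old rerouting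
      -- applies.
      free′ : ∀ v → 0 < occ v (l ∷ r ∷ ls A) → Σ (List Cherry) λ us → length us ≡ suc (length (cs A)) ×
        (∀ z → occˡ us z + δ z v ≡ occ z (l ∷ r ∷ ls A)) × (∀ z → occᶜ us z ≡ occ z (w ∷ cs A))
      free′ v v∈ = case (v ≟ l) (v ≟ r)
        where
        occ-new : ∀ z → occ z (l ∷ r ∷ ls A) ≡ δ z l + (δ z r + occ z (ls A))
        occ-new z = trans (occ-∷ z l (r ∷ ls A)) (cong (δ z l +_) (occ-∷ z r (ls A)))
        centres′ : ∀ {us : List Cherry} → (∀ z → occᶜ us z ≡ occ z (cs A)) →
          ∀ z → δ z w + occᶜ us z ≡ occ z (w ∷ cs A)
        centres′ eq z = trans (cong (δ z w +_) (eq z)) (sym (occ-∷ z w (cs A)))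
        case : Dec (v ≡ l) → Dec (v ≡ r) → _
        case (yes refl) _ = cherry y~w c~r ∷ qs , cong suc len-qs
          , (λ z → trans (trans (lemma (δ z y) (δ z r) (occˡ qs z) (δ z l))
                     (cong (λ n → δ z l + (δ z r + n)) (leaves-qs z))) (sym (occ-new z)))
          , centres′ {qs} centres-qs
          where
          lemma : ∀ y r q l → y + r + q + l ≡ l + (r + (q + y))
          lemma = solve-∀
        case (no _) (yes refl) = cherry l~c (E-sym y~w) ∷ qs , cong suc len-qs
          , (λ z → trans (trans (lemma (δ z y) (δ z r) (occˡ qs z) (δ z l))
                     (cong (λ n → δ z l + (δ z r + n)) (leaves-qs z))) (sym (occ-new z)))
          , centres′ {qs} centres-qs
          where
          lemma : ∀ y r q l → l + y + q + r ≡ l + (r + (q + y))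
          lemma = solve-∀
        case (no v≢l) (no v≢r) with free A v
          (subst (0 <_) (trans (occ-new v) (cong₂ (λ a b → a + (b + occ v (ls A))) (δ-≢ v≢l) (δ-≢ v≢r))) v∈)
        ... | us , len-us , leaves-us , centres-us = cherry l~c c~r ∷ us , cong suc len-us
          , (λ z → trans (trans (lemma (δ z v) (δ z r) (occˡ us z) (δ z l))
                     (cong (λ n → δ z l + (δ z r + n)) (leaves-us z))) (sym (occ-new z)))
          , centres′ {us} centres-us
          where
          lemma : ∀ v r q l → l + r + q + v ≡ l + (r + (q + v))
          lemma = solve-∀
      B : Alternating k
      B .es = es A
      B .rest = others
      B .cs = w ∷ cs A
      B .ls = l ∷ r ∷ ls A
      B .packs z = subst (_≤ χ S z)
        (trans (cong₂ (λ a b → occᵉ (es A) z + (a + b) + (occ z (ls A) + occ z (cs A))) (leaves-eq z) (centres-eq z))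
        (trans (lemma (occᵉ (es A) z) (δ z l) (δ z r) (occˡ others z) (δ z w) (occᶜ others z) (occ z (ls A)) (occ z (cs A)))
        (sym (cong₂ (λ a b → covered (es A) others z + (a + b))
           (trans (occ-∷ z l (r ∷ ls A)) (cong (δ z l +_) (occ-∷ z r (ls A)))) (occ-∷ z w (cs A)))))) (packs A z)
        where
        lemma : ∀ e l r o w m ls cs → e + (l + r + o + (w + m)) + (ls + cs) ≡ e + (o + m) + (l + (r + ls) + (w + cs))
        lemma = solve-∀
      B .len-ls = trans (cong (2 +_) (len-ls A)) (lemma (length (cs A)))
        where
        lemma : ∀ a → 2 + (1 + 2 * a) ≡ 1 + 2 * (1 + a)
        lemma = solve-∀
      B .size-eq = trans (trans (cong (λ n → 2 * length (es A) + 3 * n) (ℕ.+-suc (length others) (length (cs A))))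
        (cong (λ n → 2 * length (es A) + 3 * (n + length (cs A))) (sym len-eq))) (size-eq A)
      B .free = free′

    result : Step A
    result with edgeAt? w (es A)
    ... | inj₁ at = larger (absorb-edge at)
    ... | inj₂ noEdge with cherryAt w qs
    ...   | leaf x = larger (split-cherry (extract-++ʳ (rest A) x))
    -- The centres of `qs` are exactly those in `cs A`, to which `w` does not belong.
    ...   | centre x = ⊥-elim (ℕ.1+n≢0 (trans (cong (_+ occᶜ (Extract.others x) w) (sym (δ-refl w)))
                (trans (sym (Extract.centres-eq x w)) (trans (centres-qs w) w∉cs))))
    ...   | absent qˡ qᶜ with cherryAt w (rest A)
    ...     | leaf x = larger (split-cherry (extract-++ˡ qs x))
    ...     | centre x = grow x
    ...     | absent rˡ rᶜ = larger (add-edge (cong₂ _+_ noEdge (cong₂ _+_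
                  (trans (occˡ-++ qs (rest A) w) (cong₂ _+_ qˡ rˡ))
                  (trans (occᶜ-++ qs (rest A) w) (cong₂ _+_ qᶜ rᶜ)))))

  -- The condition i(H - X) ≤ 2|X| for the graph H on `S` with edge relation `E`. Letting `I` be any
  -- set of isolated vertices of H - X avoids constructing the set of all of them.
  Tough : Set
  Tough = ∀ (X I : Subset N) →
    (∀ {y} → y ∈ I → y ∈ S × y ∉ X × (∀ {w} → w ∈ S → E y w → w ∈ X)) → ∣ I ∣ ≤ 2 * ∣ X ∣

  -- From the isolation condition to a path factor

  module _ (tough : Tough) where

    advance : ∀ {k} (A : Alternating k) → Step A
    advance A with any? (λ y → any? (λ w → (1 ℕ.≤? occ y (ls A)) ×-dec (w ∈? S) ×-dec E? y w ×-dec (occ w (cs A) ℕ.≟ 0)))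
    ... | yes (y , w , y∈ls , w∈S , y~w , w∉cs) = step-along A y∈ls w∈S y~w w∉cs
    ... | no closed = ⊥-elim (ℕ.<-irrefl refl (begin-strict
        2 * length (cs A)        <⟨ ℕ.≤-reflexive (sym (len-ls A)) ⟩
        -- The leaves are counted from below, so they have to be distinct, which `packs A` ensures;
        -- the centres are counted from above.
        length (ls A)            ≤⟨ length≤∣support∣ (ls A) (λ z → ℕ.≤-trans (ls≤χ z) (χ≤1 S z)) ⟩
        ∣ support (ls A) ∣       ≤⟨ tough (support (cs A)) (support (ls A)) isolated ⟩
        2 * ∣ support (cs A) ∣   ≤⟨ ℕ.*-monoʳ-≤ 2 (∣support∣≤length (cs A)) ⟩
        2 * length (cs A)        ∎))
      where
      open ≤-Reasoning
      ls+cs≤χ : ∀ z → occ z (ls A) + occ z (cs A) ≤ χ S z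
      ls+cs≤χ z = ℕ.≤-trans (ℕ.m≤n+m _ (covered (es A) (rest A) z)) (packs A z)
      ls≤χ : ∀ z → occ z (ls A) ≤ χ S z
      ls≤χ z = ℕ.≤-trans (ℕ.m≤m+n _ (occ z (cs A))) (ls+cs≤χ z)
      isolated : ∀ {y} → y ∈ support (ls A) →
        y ∈ S × y ∉ support (cs A) × (∀ {w} → w ∈ S → E y w → w ∈ support (cs A))
      isolated {y} y∈I = 0<χ⇒∈ (ℕ.≤-trans y∈ls (ls≤χ y))
        -- A vertex that is both a leaf and a centre would have multiplicity at least 2.
        , (λ y∈X → ℕ.<⇒≱ (ℕ.+-mono-≤ y∈ls (∈-support⁻ (cs A) y∈X)) (ℕ.≤-trans (ls+cs≤χ y) (χ≤1 S y)))
        , (λ {w} w∈S y~w → ∈-support⁺ (cs A)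
            (ℕ.n≢0⇒n>0 (λ w∉cs → closed (y , w , y∈ls , w∈S , y~w , w∉cs))))
        where
        y∈ls = ∈-support⁻ (ls A) y∈I

    -- Each growth takes one cherry out of `rest`, so the number of unreached cherries bounds the
    -- number of growths before the packing is enlarged.
    augment : ∀ n {k} (A : Alternating k) → length (rest A) ≡ n → LargerPacking k
    augment n A len with advance A
    ... | larger packing = packing
    augment zero A len | grown B len′ = ⊥-elim (ℕ.0≢1+n (trans (sym len) len′))
    augment (suc n) A len | grown B len′ = augment n B (ℕ.suc-injective (trans (sym len′) len))

    -- The exploration starts with `v` as its only reached leaf and no centre, which is the case k =
    -- 0 of 2k + 1 leaves.
    initial : ∀ es ts → Packs es ts → ∀ {v} → v ∈ S → covered es ts v ≡ 0 → Alternating (size es ts)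
    initial es₀ ts₀ packs₀ {v} v∈S v-uncovered = record
      { es = es₀ ; rest = ts₀ ; cs = [] ; ls = v ∷ []
      ; packs = λ z → subst (λ n → covered es₀ ts₀ z + n ≤ χ S z) (sym (ℕ.+-identityʳ (δ z v)))
          (add-uncovered (covered es₀ ts₀) packs₀ v∈S v-uncovered z)
      ; len-ls = refl
      ; size-eq = cong (λ n → 2 * length es₀ + 3 * n) (ℕ.+-identityʳ (length ts₀))
      ; free = free₀ }
      where
      free₀ : ∀ y → 0 < occ y (v ∷ []) → Σ (List Cherry) λ qs → length qs ≡ 0 ×
        (∀ z → occˡ qs z + δ z y ≡ occ z (v ∷ [])) × (∀ z → occᶜ qs z ≡ 0)
      free₀ y y∈ with y ≟ v
      ... | yes refl = [] , refl , (λ _ → refl) , (λ _ → refl)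

    -- Every augmentation raises `size` by at least one, which preserves the bound as the fuel drops
    -- by one. Exhausted fuel would mean a packing that covers more than `N` vertices.
    enlarge : ∀ fuel es ts → Packs es ts → N < fuel + size es ts → PathFactorGE 2 S E
    enlarge fuel es ts packs bound
      with any? (λ z → (z ∈? S) ×-dec (covered es ts z ℕ.≟ 0))
    enlarge zero es ts packs bound | yes _ = ⊥-elim (ℕ.<⇒≱ bound (size≤N es ts packs))
    enlarge (suc fuel) es ts packs bound | yes (v , v∈S , uncovered)
      with augment _ (initial es ts packs v∈S uncovered) refl
    ... | es′ , ts′ , packs′ , size< = enlarge fuel es′ ts′ packs′
          (ℕ.≤-trans bound (ℕ.≤-trans (ℕ.≤-reflexive (sym (ℕ.+-suc fuel _))) (ℕ.+-monoʳ-≤ fuel size<)))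
    enlarge fuel es ts packs bound | no spanning = paths es ts , paths-valid es ts , λ z →
        (λ z∈S → trans (occ-paths es ts z) (ℕ.≤-antisym (ℕ.≤-trans (packs z) (χ≤1 S z))
            (ℕ.n≢0⇒n>0 (λ uncovered → spanning (z , z∈S , uncovered)))))
      , (λ z∉S → trans (occ-paths es ts z) (ℕ.n≤0⇒n≡0 (ℕ.≮⇒≥ (λ 0<covered →
            z∉S (0<χ⇒∈ (ℕ.≤-trans 0<covered (packs z)))))))

    tough⇒pathFactor : PathFactorGE 2 S E
    tough⇒pathFactor = enlarge (suc N) [] [] (λ _ → z≤n) (ℕ.m≤m+n (suc N) 0)

-- Isolated vertices and connectivity

adj-≢ : (G : Graph N) {x y : Fin N} → Adj G x y → x ≢ y
adj-≢ G {x} x~x refl with trans (sym x~x) (irrefl G x)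
... | ()

allᵇ-true : {A : Set} (p : A → Bool) → (∀ a → p a ≡ true) → ∀ as → allᵇ p as ≡ true
allᵇ-true p p-true [] = refl
allᵇ-true p p-true (a ∷ as) rewrite p-true a = allᵇ-true p p-true as

Isolated : Graph N → Subset N → Fin N → Set
Isolated G X y = y ∉ X × (∀ {w} → Adj G y w → w ∈ X)

∈-isolatedSet : (G : Graph N) (X : Subset N) {y : Fin N} → Isolated G X y → y ∈ isolatedSet G X
∈-isolatedSet G X {y} (y∉X , nbrs) =
  lookup⇒[]= y _ (trans (lookup∘tabulate (isIsolatedᵇ G X) y) isolated)
  where
  y-outside : lookup X y ≡ false
  y-outside with lookup X y in eq
  ... | true = ⊥-elim (y∉X (lookup⇒[]= y X eq))
  ... | false = refl
  nbr-inside : ∀ w → not (adj G y w) ∨ lookup X w ≡ true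
  nbr-inside w with adj G y w in eq
  ... | true = []=⇒lookup (nbrs eq)
  ... | false = refl
  isolated : isIsolatedᵇ G X y ≡ true
  isolated rewrite y-outside = allᵇ-true _ nbr-inside (allFin _)

-- A walk from `y` to another vertex has a first step, and it ends at a neighbour of `y` outside
-- `X`.
connected⇒no-isolated : (G : Graph N) (X : Subset N) {y z : Fin N} → ConnectedMinus G X →
  z ∉ X → z ≢ y → ¬ Isolated G X y
connected⇒no-isolated G X {y} {z} connected z∉X z≢y (y∉X , nbrs) with connected y z y∉X z∉X
... | here = z≢y refl
... | step y~w w∉X _ = w∉X (nbrs y~w)

complete⇒connectedMinus : (G : Graph N) → Complete G → ∀ X → ConnectedMinus G X
complete⇒connectedMinus G complete X x y _ y∉X with x ≟ y
... | yes refl = here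
... | no x≢y = step (complete x y x≢y) y∉X here

-- The ratio (n + 1 + x) / (2x) decreases in x and equals the toughness bound at x = r + 2. For x =
-- r + 2 + d the two sides differ by exactly 2d(n + 1).
toughness-bound : ∀ n r x → r + 2 ≤ x → suc (n + x) * (2 * (r + 2)) ≤ (n + r + 3) * (2 * x)
toughness-bound n r x r+2≤x with ℕ.m≤n⇒∃[o]m+o≡n r+2≤x
... | d , refl = ℕ.≤-trans (ℕ.m≤m+n _ (2 * (d * (n + 1)))) (ℕ.≤-reflexive (lemma n r d))
  where
  lemma : ∀ n r d → (1 + (n + (r + 2 + d))) * (2 * (r + 2)) + 2 * (d * (n + 1)) ≡ (n + r + 3) * (2 * (r + 2 + d))
  lemma = solve-∀

-- The graph G - W - uv

module _ (n r : ℕ) (G : Graph N) (k-connected : KConnected G (n + r + 2))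
  (tough : IsolatedToughnessGT G (n + r + 3) (2 * (r + 2)))
  (W : Subset N) (∣W∣≡n : ∣ W ∣ ≡ n) (u v : Fin N) (u~v : Adj G u v)
  where

  E : Fin N → Fin N → Set
  E = AdjMinusEdge G u v

  E? : ∀ x y → Dec (E x y)
  E? x y = (adj G x y Bool.≟ true) ×-dec ¬? (((x ≟ u) ×-dec (y ≟ v)) ⊎-dec ((x ≟ v) ×-dec (y ≟ u)))

  E-sym : ∀ {x y} → E x y → E y x
  E-sym {x} {y} (x~y , xy≢uv) = trans (adj-sym G y x) x~y , λ where
    (inj₁ (y≡u , x≡v)) → xy≢uv (inj₂ (x≡v , y≡u))
    (inj₂ (y≡v , x≡u)) → xy≢uv (inj₁ (x≡u , y≡v))

  open StarFactor (∁ W) E E? E-sym (λ x~x → adj-≢ G (proj₁ x~x) refl)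

  -- Refuting a violation of the isolation condition

  module _ (X I : Subset N)
    (I-isolated : ∀ {y} → y ∈ I → y ∈ ∁ W × y ∉ X × (∀ {w} → w ∈ ∁ W → E y w → w ∈ X))
    (2∣X∣<∣I∣ : 2 * ∣ X ∣ < ∣ I ∣) where

    I∌W : ∀ {y} → y ∈ I → y ∉ W
    I∌W y∈I = x∈∁p⇒x∉p (proj₁ (I-isolated y∈I))

    I∌W∪X : ∀ {y} → y ∈ I → y ∉ W ∪ X
    I∌W∪X y∈I y∈W∪X with x∈p∪q⁻ W X y∈W∪X
    ... | inj₁ y∈W = I∌W y∈I y∈W
    ... | inj₂ y∈X = proj₁ (proj₂ (I-isolated y∈I)) y∈X

    nbr : ∀ {y w} → y ∈ I → Adj G y w → ¬ ((y ≡ u × w ≡ v) ⊎ (y ≡ v × w ≡ u)) → w ∈ W ∪ X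
    nbr {y} {w} y∈I y~w yw≢uv with w ∈? W
    ... | yes w∈W = x∈p∪q⁺ (inj₁ w∈W)
    ... | no w∉W = x∈p∪q⁺ (inj₂ (proj₂ (proj₂ (I-isolated y∈I)) (x∉p⇒x∈∁p w∉W) (y~w , yw≢uv)))

    ∣W∪X∣≤n+∣X∣ : ∣ W ∪ X ∣ ≤ n + ∣ X ∣
    ∣W∪X∣≤n+∣X∣ = subst (λ m → ∣ W ∪ X ∣ ≤ m + ∣ X ∣) ∣W∣≡n (∣p∪q∣≤∣p∣+∣q∣ W X)

    -- Deleting one end of uv as well makes every other vertex of I isolated in G.
    isolated-without-end : ∀ {y o} → y ∈ I → y ≢ o → o ≡ u ⊎ (y ≡ u × o ≡ v) →
      Isolated G ((W ∪ X) ∪ ⁅ o ⁆) y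
    isolated-without-end {y} {o} y∈I y≢o end = y∉ , nbrs
      where
      y∉ : y ∉ (W ∪ X) ∪ ⁅ o ⁆
      y∉ y∈ with x∈p∪q⁻ (W ∪ X) ⁅ o ⁆ y∈
      ... | inj₁ y∈W∪X = I∌W∪X y∈I y∈W∪X
      ... | inj₂ y∈⁅o⁆ = y≢o (x∈⁅y⁆⇒x≡y o y∈⁅o⁆)
      other-end : ∀ {w} → (y ≡ u × w ≡ v) ⊎ (y ≡ v × w ≡ u) → o ≡ u ⊎ (y ≡ u × o ≡ v) → w ≡ o
      other-end (inj₁ (refl , _)) (inj₁ o≡u) = ⊥-elim (y≢o (sym o≡u))
      other-end (inj₁ (_ , w≡v)) (inj₂ (_ , o≡v)) = trans w≡v (sym o≡v)
      other-end (inj₂ (_ , w≡u)) (inj₁ o≡u) = trans w≡u (sym o≡u)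
      other-end (inj₂ (refl , _)) (inj₂ (v≡u , _)) = ⊥-elim (adj-≢ G u~v (sym v≡u))
      nbrs : ∀ {w} → Adj G y w → w ∈ (W ∪ X) ∪ ⁅ o ⁆
      nbrs {w} y~w with w ≟ o
      ... | yes refl = x∈p∪q⁺ (inj₂ (x∈⁅x⁆ w))
      ... | no w≢o = x∈p∪q⁺ (inj₁ (nbr y∈I y~w (λ yw≡uv → w≢o (other-end yw≡uv end))))

    -- If `X` were empty, deleting `W` and one end of `uv`, at most n + 1 < n + r + 2 vertices,
    -- would isolate some `y` in `I`. Since N > n + r + 2, another vertex survives, against
    -- connectivity.
    ∣X∣≢0 : ∣ X ∣ ≢ 0
    ∣X∣≢0 ∣X∣≡0 with ∣p∣<∣q∣⇒∃∈q∉p ⊥ I (subst (_< ∣ I ∣) (sym (∣⊥∣≡0 N)) (ℕ.≤-<-trans z≤n 2∣X∣<∣I∣))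
    ... | y , y∈I , _ = absurd (y ≟ u)
      where
      not-separated : ∀ {o} → y ≢ o → ¬ (o ≡ u ⊎ (y ≡ u × o ≡ v))
      not-separated {o} y≢o end = connected⇒no-isolated G Y
        (proj₂ k-connected Y (ℕ.≤-<-trans ∣Y∣≤1+n (ℕ.≤-trans (s≤s (s≤s (ℕ.m≤m+n n r))) (ℕ.≤-reflexive (ℕ.+-comm 2 (n + r))))))
        (λ z∈Y → proj₂ (proj₂ third) (x∈p∪q⁺ (inj₁ z∈Y)))
        (λ z≡y → proj₂ (proj₂ third) (x∈p∪q⁺ (inj₂ (subst (_∈ ⁅ y ⁆) (sym z≡y) (x∈⁅x⁆ y)))))
        (isolated-without-end y∈I y≢o end)
        where
        Y : Subset N
        Y = (W ∪ X) ∪ ⁅ o ⁆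
        ∣Y∣≤1+n : ∣ Y ∣ ≤ suc n
        ∣Y∣≤1+n = ℕ.≤-trans (∣p∪⁅x⁆∣≤1+∣p∣ (W ∪ X) o)
          (s≤s (subst (∣ W ∪ X ∣ ≤_) (trans (cong (n +_) ∣X∣≡0) (ℕ.+-identityʳ n)) ∣W∪X∣≤n+∣X∣))
        third : ∃ λ z → z ∈ ⊤ × z ∉ Y ∪ ⁅ y ⁆
        third = ∣p∣<∣q∣⇒∃∈q∉p (Y ∪ ⁅ y ⁆) ⊤ (begin-strict
          ∣ Y ∪ ⁅ y ⁆ ∣   ≤⟨ ∣p∪⁅x⁆∣≤1+∣p∣ Y y ⟩
          suc ∣ Y ∣       ≤⟨ s≤s ∣Y∣≤1+n ⟩
          2 + n           ≤⟨ ℕ.+-monoʳ-≤ 2 (ℕ.m≤m+n n r) ⟩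
          2 + (n + r)     ≡⟨ ℕ.+-comm 2 (n + r) ⟩
          n + r + 2       <⟨ proj₁ k-connected ⟩
          N               ≡⟨ ∣⊤∣≡n N ⟨
          ∣ ⊤ {N} ∣       ∎)
          where open ≤-Reasoning
      -- The deleted end has to differ from `y`: it is `v` if `y` is `u`, and `u` otherwise.
      absurd : Dec (y ≡ u) → Empty
      absurd (yes refl) = not-separated (adj-≢ G u~v) (inj₂ (refl , refl))
      absurd (no y≢u) = not-separated y≢u (inj₁ refl)

    -- Supplies the side condition i ≥ 2 of isolated toughness, and with the excess it gives |I| ≥
    -- 3.
    2≤2∣X∣ : 2 ≤ 2 * ∣ X ∣
    2≤2∣X∣ = ℕ.*-monoʳ-≤ 2 (ℕ.n≢0⇒n>0 ∣X∣≢0)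

    -- A complete graph, whose toughness is infinite, stays connected under any deletion. Otherwise
    -- toughness forces |X| < r + 2, and then `W ∪ X` is too small to separate `G`.
    W∪X-connected : ConnectedMinus G (W ∪ X)
    W∪X-connected = [ (λ complete → complete⇒connectedMinus G complete (W ∪ X)) , (λ t → bounded (proj₂ t)) ]′ tough
      where
      bounded : (∀ Y → 2 ≤ iso G Y → (n + r + 3) * iso G Y < ∣ Y ∣ * (2 * (r + 2))) → ConnectedMinus G (W ∪ X)
      bounded toughness = proj₂ k-connected (W ∪ X) (begin-strict
          ∣ W ∪ X ∣     ≤⟨ ∣W∪X∣≤n+∣X∣ ⟩
          n + ∣ X ∣     <⟨ ℕ.+-monoʳ-< n ∣X∣<r+2 ⟩
          n + (r + 2)   ≡⟨ ℕ.+-assoc n r 2 ⟨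
          n + r + 2     ∎)
        where
        open ≤-Reasoning
        Y : Subset N
        Y = (W ∪ X) ∪ ⁅ u ⁆
        I⊆ : I ⊆ isolatedSet G Y ∪ ⁅ u ⁆
        I⊆ {y} y∈I with y ≟ u
        ... | yes refl = x∈p∪q⁺ (inj₂ (x∈⁅x⁆ y))
        ... | no y≢u = x∈p∪q⁺ (inj₁ (∈-isolatedSet G Y (isolated-without-end y∈I y≢u (inj₁ refl))))
        -- The deleted vertex `u` may itself lie in `I`; this loss of one is absorbed by the
        -- strictness of `2∣X∣<∣I∣`.
        2∣X∣≤iso : 2 * ∣ X ∣ ≤ iso G Y
        2∣X∣≤iso = ℕ.≤-pred (ℕ.≤-trans 2∣X∣<∣I∣
          (ℕ.≤-trans (p⊆q⇒∣p∣≤∣q∣ I⊆) (∣p∪⁅x⁆∣≤1+∣p∣ (isolatedSet G Y) u)))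
        ∣X∣<r+2 : ∣ X ∣ < r + 2
        ∣X∣<r+2 = ℕ.≰⇒> (λ r+2≤∣X∣ → ℕ.<-irrefl refl (begin-strict
          (n + r + 3) * (2 * ∣ X ∣)           ≤⟨ ℕ.*-monoʳ-≤ (n + r + 3) 2∣X∣≤iso ⟩
          (n + r + 3) * iso G Y               <⟨ toughness Y (ℕ.≤-trans 2≤2∣X∣ 2∣X∣≤iso) ⟩
          ∣ Y ∣ * (2 * (r + 2))               ≤⟨ ℕ.*-monoˡ-≤ (2 * (r + 2)) (ℕ.≤-trans (∣p∪⁅x⁆∣≤1+∣p∣ (W ∪ X) u) (s≤s ∣W∪X∣≤n+∣X∣)) ⟩
          suc (n + ∣ X ∣) * (2 * (r + 2))     ≤⟨ toughness-bound n r ∣ X ∣ r+2≤∣X∣ ⟩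
          (n + r + 3) * (2 * ∣ X ∣)           ∎))

    -- A vertex `y` of `I` off the edge `uv` has the same neighbours in `G` as in G - uv, so it is
    -- isolated in G - (W ∪ X).
    excess-impossible : Empty
    excess-impossible
      with ∣p∣<∣q∣⇒∃∈q∉p (⁅ u ⁆ ∪ ⁅ v ⁆) I (ℕ.≤-<-trans (∣p∪⁅x⁆∣≤1+∣p∣ ⁅ u ⁆ v)
             (ℕ.≤-<-trans (subst (λ m → suc m ≤ 2) (sym (∣⁅x⁆∣≡1 u)) (s≤s (s≤s z≤n))) (ℕ.≤-<-trans 2≤2∣X∣ 2∣X∣<∣I∣)))
    ... | y , y∈I , y∉uv
      -- A second vertex `z` of `I` also survives the deletion, so the isolation of `y` contradicts
      -- connectivity.
      with ∣p∣<∣q∣⇒∃∈q∉p ⁅ y ⁆ I (subst (_< ∣ I ∣) (sym (∣⁅x⁆∣≡1 y))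
             (ℕ.<-trans (s≤s (s≤s z≤n)) (ℕ.≤-<-trans 2≤2∣X∣ 2∣X∣<∣I∣)))
    ...   | z , z∈I , z∉y = connected⇒no-isolated G (W ∪ X) W∪X-connected (I∌W∪X z∈I)
            (λ { refl → z∉y (x∈⁅x⁆ z) })
            (I∌W∪X y∈I , λ y~w → nbr y∈I y~w λ where
              (inj₁ (refl , _)) → y∉uv (x∈p∪q⁺ (inj₁ (x∈⁅x⁆ u)))
              (inj₂ (refl , _)) → y∉uv (x∈p∪q⁺ (inj₂ (x∈⁅x⁆ v))))

  pathFactor-avoiding-edge : PathFactorGE 2 (∁ W) E
  pathFactor-avoiding-edge = tough⇒pathFactor λ X I I-isolated → ℕ.≮⇒≥ (excess-impossible X I I-isolated)

theorem6 : ∀ (n r : ℕ) {N : ℕ} (G : Graph N) →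
    KConnected G (n + r + 2) →
    IsolatedToughnessGT G (n + r + 3) (2 * (r + 2)) →
    PkFactorCriticalAvoidable G 2 n
theorem6 n r G k-connected tough W ∣W∣≡n u v _ _ u~v =
  pathFactor-avoiding-edge n r G k-connected tough W ∣W∣≡n u v u~v
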